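{- Let $G$ be a graph and let $\mathcal{P} = (A_1, \dots, A_k)$ be a monotone partition of $V(G)$ into cliques $A_1, \dots, A_k$. If $\mathcal{P}$ has the hev-property, then $G$ has clique-width at most $k+1$.
   Context: Graphs are finite and simple. Parts of a partition are allowed to be empty. For a vertex $v$ and a set $Y$ of vertices, $N_Y(v)$ is the set of neighbours of $v$ lying in $Y$. For disjoint sets $X, Y$ of vertices, $X$ is complete (resp. anticomplete) to $Y$ if all possible edges (resp. no edges) between $X$ and $Y$ are present; $X$ is uniform to $Y$ if it is complete or anticomplete to $Y$; a vertex $v$ is uniform to $Y$ if $\{v\}$ is. $X$ is monotone to $Y$ if for all $u,v \in X$, either $N_Y(u) \subseteq N_Y(v)$ or $N_Y(v) \subseteq N_Y(u)$. A partition $\mathcal{P} = (A_1,\dots,A_k)$ of $V(G)$ is monotone if for every $i$, $A_i$ is monotone to $V(G)\setminus A_i$. In a monotone partition, a vertex $v\in A_i$ is maximal (resp. minimal) if $N_{V(G)\setminus A_i}(v)$ is inclusion-wise maximal (resp. minimal) among the sets $N_{V(G)\setminus A_i}(u)$, $u \in A_i$; it is extreme if it is maximal or minimal. A monotone partition $\mathcal{P}$ has the extreme vertex property if there exist $i\in\{1,\dots,k\}$ and an extreme vertex $v$ of $A_i$ such that $v$ is uniform to $A_j$ for all $j\in\{1,\dots,k\}\setminus\{i\}$. $\mathcal{P}$ has the hereditary extreme vertex property (hev-property) if for every non-empty set $X\subseteq V(G)$, the partition $\mathcal{P}[X] = (A_1\cap X,\dots,A_k\cap X)$ of $X$ has the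 extreme vertex property in the induced subgraph $G[X]$. The clique-width of a graph $G$ is the minimum number of labels needed to build $G$ by the following four operations: (1) create a vertex with label $i$; (2) take the disjoint union of two previously constructed labelled graphs; (3) for some $i \neq j$, join by an edge every vertex with label $i$ to every vertex with label $j$; (4) relabel all vertices with label $i$ by label $j$. -}

module Defs where

open import Data.Bool.Base using (if_then_else_)
open import Data.Empty using (⊥-elim) renaming (⊥ to Void)
open import Data.Fin.Base using (Fin)
open import Data.Fin.Properties using (_≟_)
open import Data.Fin.Subset
  using (Subset; _∈_; _∉_; _⊆_; _⊄_; _∩_; _─_; ⁅_⁆; ⊥; Empty; Nonempty)
open import Data.Fin.Subset.Properties
  using (_∈?_; ∉⊥; x∈p∩q⁺; x∈p∩q⁻)
open import Data.Nat.Base using (ℕ; _≤_)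
open import Data.Product.Base using (∃; ∃-syntax; _×_; _,_; proj₁; proj₂)
open import Data.Sum.Base using (_⊎_; inj₁; inj₂)
open import Data.Unit.Base renaming (⊤ to Unit)
open import Function.Bundles using (_⇔_; _↔_; Inverse)
open import Relation.Binary.PropositionalEquality using (_≡_; _≢_)
open import Relation.Nullary using (does; yes; no)

private
  variable
    n k c : ℕ

-- A finite simple graph whose vertex set V is a set of elements of Fin n, not
-- necessarily all of them; this lets an induced subgraph keep the names of its
-- vertices.  Adjacency of u and v is  u ∈ N v.
record Graph (n : ℕ) : Set where
  field
    V      : Subset n
    N      : Fin n → Subset n
    N⊆V    : ∀ {u v} → u ∈ N v → u ∈ V
    sym    : ∀ {u v} → u ∈ N v → v ∈ N u
    irrefl : ∀ {v} → v ∉ N v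

open Graph

Adj : Graph n → Fin n → Fin n → Set
Adj G u v = u ∈ N G v

inducedN : Graph n → Subset n → Fin n → Subset n
inducedN G X v = if does (v ∈? X) then N G v ∩ X else ⊥

private
  inducedN⁻ : ∀ (G : Graph n) X {u v} → u ∈ inducedN G X v →
              u ∈ N G v × u ∈ X × v ∈ X
  inducedN⁻ G X {u} {v} p with v ∈? X
  ... | yes v∈X = let (a , b) = x∈p∩q⁻ (N G v) X p in a , b , v∈X
  ... | no  _   = ⊥-elim (∉⊥ p)

  inducedN⁺ : ∀ (G : Graph n) X {u v} → u ∈ N G v → u ∈ X → v ∈ X →
              u ∈ inducedN G X v
  inducedN⁺ G X {u} {v} a u∈X v∈X with v ∈? X
  ... | yes _   = x∈p∩q⁺ (a , u∈X)
  ... | no  v∉X = ⊥-elim (v∉X v∈X)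

infix 8 _[_]

_[_] : Graph n → Subset n → Graph n
(G [ X ]) .V = V G ∩ X
(G [ X ]) .N = inducedN G X
(G [ X ]) .N⊆V p =
  let (a , u∈X , _) = inducedN⁻ G X p in x∈p∩q⁺ (N⊆V G a , u∈X)
(G [ X ]) .sym p =
  let (a , u∈X , v∈X) = inducedN⁻ G X p in inducedN⁺ G X (sym G a) v∈X u∈X
(G [ X ]) .irrefl p = irrefl G (proj₁ (inducedN⁻ G X p))

module _ (G : Graph n) where

  NbrsIn : Subset n → Fin n → Subset n
  NbrsIn Y v = N G v ∩ Y

  IsClique : Subset n → Set
  IsClique X = ∀ {u v} → u ∈ X → v ∈ X → u ≢ v → Adj G u v

  Complete Anticomplete Uniform Monotone : Subset n → Subset n → Set
  Complete     X Y = ∀ {x y} → x ∈ X → y ∈ Y → y ∈ N G x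
  Anticomplete X Y = ∀ {x y} → x ∈ X → y ∈ Y → y ∉ N G x
  Uniform      X Y = Complete X Y ⊎ Anticomplete X Y
  Monotone     X Y = ∀ {u v} → u ∈ X → v ∈ X →
                     NbrsIn Y u ⊆ NbrsIn Y v ⊎ NbrsIn Y v ⊆ NbrsIn Y u

  module _ (A : Fin k → Subset n) where

    -- Parts may be empty.
    record IsPartition : Set where
      field
        parts⊆V  : ∀ i → A i ⊆ V G
        cover    : ∀ {v} → v ∈ V G → ∃[ i ] v ∈ A i
        disjoint : ∀ {v i j} → v ∈ A i → v ∈ A j → i ≡ j

    record IsMonotonePartition : Set where
      field
        isPartition : IsPartition
        monotone    : ∀ i → Monotone (A i) (V G ─ A i)

    OutNbrs : Fin k → Fin n → Subset n
    OutNbrs i = NbrsIn (V G ─ A i)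

    Maximal Minimal Extreme : Fin k → Fin n → Set
    Maximal i v = v ∈ A i × (∀ {u} → u ∈ A i → OutNbrs i v ⊄ OutNbrs i u)
    Minimal i v = v ∈ A i × (∀ {u} → u ∈ A i → OutNbrs i u ⊄ OutNbrs i v)
    Extreme i v = Maximal i v ⊎ Minimal i v

    ExtremeVertexProperty : Set
    ExtremeVertexProperty =
      ∃[ i ] ∃[ v ] Extreme i v × (∀ j → j ≢ i → Uniform ⁅ v ⁆ (A j))

HevProperty : Graph n → (Fin k → Subset n) → Set
HevProperty G A = ∀ X → X ⊆ V G → Nonempty X →
                  ExtremeVertexProperty (G [ X ]) (λ i → A i ∩ X)

record LabelledGraph (c : ℕ) : Set₁ where
  field
    Vertex : Set
    Edge   : Vertex → Vertex → Set
    label  : Vertex → Fin c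

open LabelledGraph

single : Fin c → LabelledGraph c
single i .Vertex   = Unit
single i .Edge _ _ = Void
single i .label _  = i

disjointUnion : LabelledGraph c → LabelledGraph c → LabelledGraph c
disjointUnion H K .Vertex = Vertex H ⊎ Vertex K
disjointUnion H K .Edge (inj₁ x) (inj₁ y) = Edge H x y
disjointUnion H K .Edge (inj₂ x) (inj₂ y) = Edge K x y
disjointUnion H K .Edge (inj₁ _) (inj₂ _) = Void
disjointUnion H K .Edge (inj₂ _) (inj₁ _) = Void
disjointUnion H K .label (inj₁ x) = label H x
disjointUnion H K .label (inj₂ y) = label K y

joinLabels : Fin c → Fin c → LabelledGraph c → LabelledGraph c
joinLabels i j H .Vertex = Vertex H
joinLabels i j H .Edge x y = Edge H x y
                           ⊎ (label H x ≡ i × label H y ≡ j)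
                           ⊎ (label H x ≡ j × label H y ≡ i)
joinLabels i j H .label = label H

relabelAll : Fin c → Fin c → LabelledGraph c → LabelledGraph c
relabelAll i j H .Vertex  = Vertex H
relabelAll i j H .Edge    = Edge H
relabelAll i j H .label x = if does (label H x ≟ i) then j else label H x

data Expr (c : ℕ) : Set where
  create  : Fin c → Expr c
  union   : Expr c → Expr c → Expr c
  join    : (i j : Fin c) → i ≢ j → Expr c → Expr c
  relabel : (i j : Fin c) → Expr c → Expr c

⟦_⟧ : Expr c → LabelledGraph c
⟦ create i ⟧      = single i
⟦ union d e ⟧     = disjointUnion ⟦ d ⟧ ⟦ e ⟧
⟦ join i j _ e ⟧  = joinLabels i j ⟦ e ⟧
⟦ relabel i j e ⟧ = relabelAll i j ⟦ e ⟧

-- Isomorphism of graphs, forgetting the labels.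
record _≅_ (H : LabelledGraph c) (G : Graph n) : Set where
  field
    bijection : Vertex H ↔ ∃ (_∈ V G)

  name : Vertex H → Fin n
  name x = proj₁ (Inverse.to bijection x)

  field
    edges : ∀ x y → Edge H x y ⇔ Adj G (name x) (name y)

-- The four operations never produce the graph without vertices; by convention
-- it needs no operation, hence no labels, so that its clique-width is 0.
Buildable : Graph n → ℕ → Set
Buildable G c = Empty (V G) ⊎ (∃[ e ] ⟦_⟧ {c} e ≅ G)

-- Clique-width is the least c with Buildable G c, and a minimum over a set of
-- natural numbers is at most m when the set has an element that is at most m.
-- (Exhibiting the minimum itself would require deciding Buildable.)
CliqueWidthAtMost : Graph n → ℕ → Set
CliqueWidthAtMost G m = ∃[ c ] c ≤ m × Buildable G c

{-# OPTIONS --safe #-}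

-- Delete a vertex v of G[X] that is uniform to every part other than its own,
-- and build the rest of G[X] with the vertices of the i-th part labelled i.
-- Since parts are cliques, v is uniform to what is left of its own part too, so
-- it can be created with one extra label, joined to the labels of the parts
-- that contain a neighbour of it, and then relabelled to its own part.
module Submission where

open import Defs
open import Data.Bool.Base using (if_then_else_)
open import Data.Empty using (⊥-elim)
open import Data.Fin.Base using (Fin; zero; suc)
open import Data.Fin.Properties using (_≟_; any?; 0≢1+n; suc-injective)
open import Data.Fin.Subset
  using (Subset; _∈_; _⊆_; _⊂_; _∩_; _-_; Empty; Nonempty)
open import Data.Fin.Subset.Induction using (⊂-wellFounded; Acc; acc)
open import Data.Fin.Subset.Properties
  using ( _∈?_; nonempty?; ∉⊥; x∈⁅x⁆; x∈p∩q⁺; x∈p∩q⁻; p─q⊆p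
        ; x∈p∧x≢y⇒x∈p-y; x∈p⇒p-x⊂p)
open import Data.List.Base using (List; []; _∷_; filter; allFin)
open import Data.List.Membership.Propositional
  using () renaming (_∈_ to _∈ₗ_)
open import Data.List.Membership.Propositional.Properties
  using (∈-allFin; ∈-filter⁺; ∈-filter⁻)
open import Data.List.Relation.Unary.Any using (here; there)
open import Data.Nat.Base using (ℕ; suc; _+_)
open import Data.Nat.Properties using (+-comm; ≤-reflexive)
open import Data.Product.Base using (∃-syntax; _×_; _,_; proj₁; proj₂)
open import Data.Sum.Base using (_⊎_; inj₁; inj₂; [_,_]′)
open import Data.Unit.Base using (tt)
open import Data.Vec.Base using (_∷_; there)
open import Data.Vec.Properties.WithK using ([]=-irrelevant)
open import Function.Base using (_∘_)
open import Function.Bundles using (_⇔_; mk⇔; mk↔ₛ′; Equivalence)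
open import Relation.Binary.PropositionalEquality
  using (_≡_; _≢_; refl; sym; trans; cong; subst)
open import Relation.Nullary using (Dec; does; yes; no; _×-dec_)
open import Relation.Unary using (Decidable)

open Graph using (V; N)
open LabelledGraph
open IsPartition
open IsMonotonePartition

private
  variable
    n k c : ℕ

-- Vertex deletion and induced neighbourhoods.

x∈p-y⇒x≢y : ∀ {x y} (p : Subset n) → x ∈ p - y → x ≢ y
x∈p-y⇒x≢y {x = zero}  (_ ∷ p) () refl
x∈p-y⇒x≢y {x = suc x} (_ ∷ p) (there x∈) refl = x∈p-y⇒x≢y p x∈ refl

∈-inducedN⁻ : ∀ (G : Graph n) X {u v} → u ∈ inducedN G X v → u ∈ N G v
∈-inducedN⁻ G X {v = v} u∈ with v ∈? X
... | yes _ = proj₁ (x∈p∩q⁻ (N G v) X u∈)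
... | no  _ = ⊥-elim (∉⊥ u∈)

∈-inducedN⁺ : ∀ (G : Graph n) X {u v} →
              u ∈ N G v → u ∈ X → v ∈ X → u ∈ inducedN G X v
∈-inducedN⁺ G X {v = v} u∈N u∈X v∈X with v ∈? X
... | yes _   = x∈p∩q⁺ (u∈N , u∈X)
... | no  v∉X = ⊥-elim (v∉X v∈X)

-- Labelled graphs on named vertices, and the effect of joins and relabellings.

-- Edges and labels are compared with an arbitrary relation and function on names, so the
-- intermediate stages of a construction, which are not induced subgraphs of `G`, can be described
-- too.
record Realizes (H : LabelledGraph c) (X : Subset n)
                (E : Fin n → Fin n → Set) (ℓ : Fin n → Fin c) : Set where
  field
    name      : Vertex H → Fin n
    name∈     : ∀ x → name x ∈ X
    injective : ∀ {x y} → name x ≡ name y → x ≡ y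
    onto      : ∀ {u} → u ∈ X → ∃[ x ] name x ≡ u
    edge      : ∀ x y → Edge H x y ⇔ E (name x) (name y)
    label-ok  : ∀ x → label H x ≡ ℓ (name x)

open Realizes

private
  variable
    H : LabelledGraph c
    X : Subset n
    E E′ : Fin n → Fin n → Set
    ℓ ℓ′ : Fin n → Fin c

-- Only the values of `E` and `ℓ` on `X` matter. Each operation is first described by the formula it
-- produces; this lemma then exchanges that formula for the intended one.
Realizes-cong : (∀ {u w} → u ∈ X → w ∈ X → E u w ⇔ E′ u w) →
                (∀ {u} → u ∈ X → ℓ u ≡ ℓ′ u) →
                Realizes H X E ℓ → Realizes H X E′ ℓ′
Realizes-cong E⇔E′ ℓ≗ℓ′ r = record
  { name      = name r
  ; name∈     = name∈ r
  ; injective = injective r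
  ; onto      = onto r
  ; edge      = λ x y → mk⇔
      (Equivalence.to (E⇔E′ (name∈ r x) (name∈ r y)) ∘ Equivalence.to (edge r x y))
      (Equivalence.from (edge r x y) ∘ Equivalence.from (E⇔E′ (name∈ r x) (name∈ r y)))
  ; label-ok  = λ x → trans (label-ok r x) (ℓ≗ℓ′ (name∈ r x))
  }

Joined : Fin c → Fin c → (Fin n → Fin c) → Fin n → Fin n → Set
Joined i j ℓ u w = (ℓ u ≡ i × ℓ w ≡ j) ⊎ (ℓ u ≡ j × ℓ w ≡ i)

Realizes-join : ∀ i j → Realizes H X E ℓ →
                Realizes (joinLabels i j H) X (λ u w → E u w ⊎ Joined i j ℓ u w) ℓ
Realizes-join {H = H} {E = E} {ℓ = ℓ} i j r = record
  { name      = name r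
  ; name∈     = name∈ r
  ; injective = injective r
  ; onto      = onto r
  ; edge      = edge′
  ; label-ok  = label-ok r
  }
  where
  edge′ : ∀ x y → Edge (joinLabels i j H) x y ⇔
                  (E (name r x) (name r y) ⊎ Joined i j ℓ (name r x) (name r y))
  -- With labels rewritten to `ℓ` of the names, the edges added by the join are literally the same
  -- on both sides.
  edge′ x y rewrite label-ok r x | label-ok r y = mk⇔
    [ inj₁ ∘ Equivalence.to (edge r x y) , inj₂ ]′
    [ inj₁ ∘ Equivalence.from (edge r x y) , inj₂ ]′

Realizes-relabel : ∀ i j → Realizes H X E ℓ →
                   Realizes (relabelAll i j H) X E
                            (λ u → if does (ℓ u ≟ i) then j else ℓ u)
Realizes-relabel i j r = record
  { name      = name r
  ; name∈     = name∈ r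
  ; injective = injective r
  ; onto      = onto r
  ; edge      = edge r
  ; label-ok  = λ x → cong (λ l → if does (l ≟ i) then j else l) (label-ok r x)
  }

-- `zero` is the extra label and successors are the labels of parts, so the two joined labels always
-- differ.
joinAll : List (Fin k) → Expr (suc k) → Expr (suc k)
joinAll []       e = e
joinAll (j ∷ js) e = join zero (suc j) 0≢1+n (joinAll js e)

-- Joins never change labels, so the same `ℓ` describes every stage and the new edges simply
-- accumulate.
Realizes-joinAll : ∀ js (e : Expr (suc k)) → Realizes ⟦ e ⟧ X E ℓ →
                   Realizes ⟦ joinAll js e ⟧ X
                     (λ u w → E u w ⊎ ∃[ j ] j ∈ₗ js × Joined zero (suc j) ℓ u w) ℓ
Realizes-joinAll []       e r = Realizes-cong
  (λ _ _ → mk⇔ inj₁ λ { (inj₁ uw) → uw ; (inj₂ (_ , () , _)) })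
  (λ _ → refl) r
Realizes-joinAll (j ∷ js) e r = Realizes-cong
  (λ _ _ → mk⇔
    (λ { (inj₁ (inj₁ uw))              → inj₁ uw
       ; (inj₁ (inj₂ (i , i∈js , uw))) → inj₂ (i , there i∈js , uw)
       ; (inj₂ uw)                     → inj₂ (j , here refl , uw) })
    (λ { (inj₁ uw)                    → inj₁ (inj₁ uw)
       ; (inj₂ (_ , here refl , uw))  → inj₂ uw
       ; (inj₂ (i , there i∈js , uw)) → inj₁ (inj₂ (i , i∈js , uw)) }))
  (λ _ → refl)
  (Realizes-join zero (suc j) (Realizes-joinAll js e r))

-- Inserting one vertex.

recolour : Fin n → Fin c → (Fin n → Fin c) → Fin n → Fin c
recolour v i ℓ u = if does (u ≟ v) then i else ℓ u

recolour-≡ : ∀ (v : Fin n) {i : Fin c} (ℓ : Fin n → Fin c) → recolour v i ℓ v ≡ i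
recolour-≡ v ℓ with v ≟ v
... | yes _   = refl
... | no  v≢v = ⊥-elim (v≢v refl)

recolour-≢ : ∀ {u v : Fin n} {i : Fin c} (ℓ : Fin n → Fin c) → u ≢ v → recolour v i ℓ u ≡ ℓ u
recolour-≢ {u = u} {v} ℓ u≢v with u ≟ v
... | yes u≡v = ⊥-elim (u≢v u≡v)
... | no  _   = refl

-- The union leaves `v` isolated, whereas `E` may relate `v` to other vertices; the two inequalities
-- discard those pairs.
Realizes-insert : ∀ {v : Fin n} (i : Fin c) → v ∈ X → Realizes H (X - v) E ℓ →
                  Realizes (disjointUnion (single i) H) X
                           (λ u w → u ≢ v × w ≢ v × E u w) (recolour v i ℓ)
Realizes-insert {n = n} {c = c} {X = X} {H = H} {E = E} {ℓ = ℓ} {v = v} i v∈X r = record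
  { name      = name′
  ; name∈     = λ { (inj₁ _) → v∈X ; (inj₂ x) → p─q⊆p X _ (name∈ r x) }
  ; injective = λ { {inj₁ _} {inj₁ _} _ → refl
                  ; {inj₁ _} {inj₂ y} v≡ → ⊥-elim (name≢v y (sym v≡))
                  ; {inj₂ x} {inj₁ _} ≡v → ⊥-elim (name≢v x ≡v)
                  ; {inj₂ x} {inj₂ y} eq → cong inj₂ (injective r eq) }
  ; onto      = onto′
  ; edge      = edge′
  ; label-ok  = λ { (inj₁ _) → sym (recolour-≡ v ℓ)
                  ; (inj₂ x) → trans (label-ok r x) (sym (recolour-≢ ℓ (name≢v x))) }
  }
  where
  K : LabelledGraph c
  K = disjointUnion (single i) H

  name′ : Vertex K → Fin n
  name′ (inj₁ _) = v
  name′ (inj₂ x) = name r x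

  name≢v : ∀ x → name r x ≢ v
  name≢v x = x∈p-y⇒x≢y X (name∈ r x)

  onto′ : ∀ {u} → u ∈ X → ∃[ x ] name′ x ≡ u
  onto′ {u} u∈X with u ≟ v
  ... | yes u≡v = inj₁ tt , sym u≡v
  ... | no  u≢v = let (x , eq) = onto r (x∈p∧x≢y⇒x∈p-y u∈X u≢v) in inj₂ x , eq

  edge′ : ∀ x y → Edge K x y ⇔ (name′ x ≢ v × name′ y ≢ v × E (name′ x) (name′ y))
  edge′ (inj₁ _) (inj₁ _) = mk⇔ (λ ()) (λ (v≢v , _) → v≢v refl)
  edge′ (inj₁ _) (inj₂ _) = mk⇔ (λ ()) (λ (v≢v , _) → v≢v refl)
  edge′ (inj₂ _) (inj₁ _) = mk⇔ (λ ()) (λ (_ , v≢v , _) → v≢v refl)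
  edge′ (inj₂ x) (inj₂ y) = mk⇔
    (λ xy → name≢v x , name≢v y , Equivalence.to (edge r x y) xy)
    (λ (_ , _ , xy) → Equivalence.from (edge r x y) xy)

-- No expression denotes the graph without vertices, so the construction has to start from one
-- vertex.
Realizes-singleton : ∀ (G : Graph n) {v} → v ∈ X → Empty (X - v) →
                     Realizes (single (ℓ v)) X (Adj G) ℓ
Realizes-singleton {X = X} G {v} v∈X X-v=∅ = record
  { name      = λ _ → v
  ; name∈     = λ _ → v∈X
  ; injective = λ _ → refl
  ; onto      = λ u∈X → tt , sym (≡v u∈X)
  ; edge      = λ _ _ → mk⇔ (λ ()) (Graph.irrefl G)
  ; label-ok  = λ _ → refl
  }
  where
  ≡v : ∀ {u} → u ∈ X → u ≡ v
  ≡v {u} u∈X with u ≟ v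
  ... | yes u≡v = u≡v
  ... | no  u≢v = ⊥-elim (X-v=∅ (u , x∈p∧x≢y⇒x∈p-y u∈X u≢v))

-- By `hom`, a label class containing a neighbour of `v` consists, apart from `v`, of neighbours of
-- `v`, so joins to whole classes give exactly the edges at `v`. The class of `ℓ v` may be one of
-- them, hence `v` keeps a label of its own until the joins are done.
addVertex : ∀ (G : Graph n) {ℓ : Fin n → Fin (suc k)} {v} → v ∈ X →
            (∀ {u} → u ∈ X → ∃[ j ] ℓ u ≡ suc j) →
            (∀ {u w} → u ∈ X → w ∈ X → w ≢ v → ℓ u ≡ ℓ w → u ∈ N G v → w ∈ N G v) →
            (e : Expr (suc k)) → Realizes ⟦ e ⟧ (X - v) (Adj G) ℓ →
            ∃[ e′ ] Realizes ⟦ e′ ⟧ X (Adj G) ℓ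
addVertex {n = n} {k = k} {X = X} G {ℓ} {v} v∈X ℓ-suc hom e r =
  relabel zero (ℓ v) (joinAll js e⁺) ,
  Realizes-cong (λ u∈X w∈X → mk⇔ (to u∈X w∈X) (from u∈X w∈X)) relabelled
    (Realizes-relabel zero (ℓ v) (Realizes-joinAll js e⁺ (Realizes-insert zero v∈X r)))
  where
  e⁺ : Expr (suc k)
  e⁺ = union (create zero) e

  ℓ⁺ : Fin n → Fin (suc k)
  ℓ⁺ = recolour v zero ℓ

  HasNbr : Fin k → Set
  HasNbr j = ∃[ u ] u ∈ X × u ∈ N G v × ℓ u ≡ suc j

  hasNbr? : Decidable HasNbr
  hasNbr? j = any? λ u → u ∈? X ×-dec u ∈? N G v ×-dec ℓ u ≟ suc j

  js : List (Fin k)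
  js = filter hasNbr? (allFin k)

  NewEdge : Fin n → Fin n → Set
  NewEdge u w = (u ≢ v × w ≢ v × Adj G u w) ⊎
                (∃[ j ] j ∈ₗ js × Joined zero (suc j) ℓ⁺ u w)

  -- On `X` all values of `ℓ` are successors, so `v` alone carries `zero` and the joins affect only
  -- pairs containing `v`.
  ℓ⁺-zero : ∀ {u} → u ∈ X → ℓ⁺ u ≡ zero → u ≡ v
  ℓ⁺-zero {u} u∈X eq with u ≟ v
  ... | yes u≡v = u≡v
  ... | no  _   = ⊥-elim (0≢1+n (trans (sym eq) (proj₂ (ℓ-suc u∈X))))

  ℓ⁺-suc : ∀ {u j} → ℓ⁺ u ≡ suc j → u ≢ v × ℓ u ≡ suc j
  ℓ⁺-suc {u} eq with u ≟ v
  ... | no u≢v = u≢v , eq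

  joined⇒nbr : ∀ {u w j} → u ∈ X → w ∈ X → j ∈ₗ js →
               ℓ⁺ u ≡ zero → ℓ⁺ w ≡ suc j → w ∈ N G u
  joined⇒nbr u∈X w∈X j∈js ℓu ℓw
    with refl ← ℓ⁺-zero u∈X ℓu | w≢v , ℓw≡ ← ℓ⁺-suc ℓw
    -- The neighbour of `v` that put `j` into `js` has the label of `w`, so `hom` passes adjacency
    -- on to `w`.
    with _ , _ , x∈X , x∈N , ℓx ← ∈-filter⁻ hasNbr? {xs = allFin k} j∈js
    = hom x∈X w∈X w≢v (trans ℓx (sym ℓw≡)) x∈N

  nbr⇒joined : ∀ {w} → w ∈ X → w ≢ v → w ∈ N G v →
               ∃[ j ] j ∈ₗ js × ℓ⁺ v ≡ zero × ℓ⁺ w ≡ suc j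
  nbr⇒joined {w} w∈X w≢v w∈N =
    let (j , ℓw) = ℓ-suc w∈X in
    j , ∈-filter⁺ hasNbr? (∈-allFin j) (w , w∈X , w∈N , ℓw) ,
    recolour-≡ v ℓ , trans (recolour-≢ ℓ w≢v) ℓw

  to : ∀ {u w} → u ∈ X → w ∈ X → NewEdge u w → Adj G u w
  to u∈X w∈X (inj₁ (_ , _ , uw)) = uw
  to u∈X w∈X (inj₂ (_ , j∈js , inj₁ (ℓu , ℓw))) =
    Graph.sym G (joined⇒nbr u∈X w∈X j∈js ℓu ℓw)
  to u∈X w∈X (inj₂ (_ , j∈js , inj₂ (ℓu , ℓw))) =
    joined⇒nbr w∈X u∈X j∈js ℓw ℓu

  from′ : ∀ {u w} → u ∈ X → w ∈ X → Dec (u ≡ v) → Dec (w ≡ v) →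
          Adj G u w → NewEdge u w
  from′ u∈X w∈X (no u≢v)   (no w≢v)   uw = inj₁ (u≢v , w≢v , uw)
  from′ u∈X w∈X (yes refl) (yes refl) uw = ⊥-elim (Graph.irrefl G uw)
  from′ u∈X w∈X (yes refl) (no w≢v)   uw =
    let (j , j∈js , ℓu , ℓw) = nbr⇒joined w∈X w≢v (Graph.sym G uw)
    in inj₂ (j , j∈js , inj₁ (ℓu , ℓw))
  from′ u∈X w∈X (no u≢v)   (yes refl) uw =
    let (j , j∈js , ℓw , ℓu) = nbr⇒joined u∈X u≢v uw
    in inj₂ (j , j∈js , inj₂ (ℓu , ℓw))

  from : ∀ {u w} → u ∈ X → w ∈ X → Adj G u w → NewEdge u w
  from {u} {w} u∈X w∈X = from′ u∈X w∈X (u ≟ v) (w ≟ v)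

  relabelled : ∀ {u} → u ∈ X → (if does (ℓ⁺ u ≟ zero) then ℓ v else ℓ⁺ u) ≡ ℓ u
  relabelled {u} u∈X with u ≟ v
  ... | yes refl = refl
  ... | no  _ with ℓ u | ℓ-suc u∈X
  -- `ℓ-suc` excludes `zero`, and relabelling `zero` fixes every successor.
  ...   | suc _ | _ = refl

-- From realizations to isomorphisms.

Realizes⇒≅ : ∀ (G : Graph n) → Realizes H (V G) (Adj G) ℓ → H ≅ G
Realizes⇒≅ G r = record
  { bijection = mk↔ₛ′
      (λ x → name r x , name∈ r x)
      (λ (_ , u∈V) → proj₁ (onto r u∈V))
      (λ (_ , u∈V) → Σ-≡ (proj₂ (onto r u∈V)))
      (λ x → injective r (proj₂ (onto r (name∈ r x))))
  ; edges = edge r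
  }
  where
  Σ-≡ : ∀ {u w} {u∈V : u ∈ V G} {w∈V : w ∈ V G} →
        u ≡ w → (u , u∈V) ≡ (w , w∈V)
  -- Membership in a subset has at most one proof.
  Σ-≡ {u} refl = cong (u ,_) ([]=-irrelevant _ _)

-- The clique-width bound, by induction on the vertex set.

theorem2p6 : ∀ {n k : ℕ} (G : Graph n) (A : Fin k → Subset n) →
    IsMonotonePartition G A →
    (∀ i → IsClique G (A i)) →
    HevProperty G A →
    CliqueWidthAtMost G (k + 1)
theorem2p6 {n} {k} G A mono clique hev =
  suc k , ≤-reflexive (+-comm 1 k) , buildable
  where
  P : IsPartition G A
  P = isPartition mono

  -- 0 is both the extra label and a junk value outside V G.
  partLabel : Fin n → Fin (suc k)
  partLabel u with u ∈? V G
  ... | yes u∈V = suc (proj₁ (cover P u∈V))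
  ... | no  _   = zero

  partLabel-suc : ∀ {u} → u ∈ V G → ∃[ j ] partLabel u ≡ suc j
  partLabel-suc {u} u∈V with u ∈? V G
  ... | yes _   = _ , refl
  ... | no  u∉V = ⊥-elim (u∉V u∈V)

  partLabel⇒∈ : ∀ {u j} → partLabel u ≡ suc j → u ∈ A j
  partLabel⇒∈ {u} eq with u ∈? V G
  ... | yes u∈V = subst (λ j → u ∈ A j) (suc-injective eq) (proj₂ (cover P u∈V))

  homogeneous : ∀ {X} → X ⊆ V G → Nonempty X → ∃[ v ] v ∈ X ×
    (∀ {u w} → u ∈ X → w ∈ X → w ≢ v → partLabel u ≡ partLabel w → u ∈ N G v → w ∈ N G v)
  homogeneous {X} X⊆V X≠∅ with hev X X⊆V X≠∅
  ... | i , v , extreme , uniform = v , v∈X , hom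
    where
    v∈A∩X : v ∈ A i ∩ X
    -- Maximal and minimal vertices alike belong to the part they are extreme in.
    v∈A∩X = [ proj₁ , proj₁ ]′ extreme

    v∈A : v ∈ A i
    v∈A = proj₁ (x∈p∩q⁻ (A i) X v∈A∩X)

    v∈X : v ∈ X
    v∈X = proj₂ (x∈p∩q⁻ (A i) X v∈A∩X)

    hom : ∀ {u w} → u ∈ X → w ∈ X → w ≢ v → partLabel u ≡ partLabel w → u ∈ N G v → w ∈ N G v
    hom {u} {w} u∈X w∈X w≢v ℓu≡ℓw u∈N with j , ℓw ← partLabel-suc (X⊆V w∈X) with j ≟ i
    -- In the part of `v` itself, adjacency comes from the clique.
    ... | yes refl = clique i (partLabel⇒∈ ℓw) v∈A w≢v
    ... | no  j≢i with uniform j j≢i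
    ...   | inj₁ complete =
      ∈-inducedN⁻ G X (complete (x∈⁅x⁆ v) (x∈p∩q⁺ (partLabel⇒∈ ℓw , w∈X)))
    ...   | inj₂ anticomplete =
      -- `u` lies in the same part as `w` and is a neighbour of `v`, which rules out
      -- anticompleteness.
      ⊥-elim (anticomplete (x∈⁅x⁆ v) (x∈p∩q⁺ (partLabel⇒∈ (trans ℓu≡ℓw ℓw) , u∈X))
                           (∈-inducedN⁺ G X u∈N u∈X v∈X))

  -- The labelling is `partLabel` for every `X`, so the expression for `X - v` already has the
  -- labels that inserting `v` requires. The hev-property supplies a new `v` at each stage.
  build : ∀ X → Acc _⊂_ X → X ⊆ V G →
          Empty X ⊎ (∃[ e ] Realizes ⟦ e ⟧ X (Adj G) partLabel)
  build X (acc rec) X⊆V with nonempty? X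
  ... | no  X=∅ = inj₁ X=∅
  ... | yes X≠∅ with v , v∈X , hom ← homogeneous X⊆V X≠∅
                with build (X - v) (rec (x∈p⇒p-x⊂p v∈X)) (X⊆V ∘ p─q⊆p X _)
  ...   | inj₁ X-v=∅   = inj₂ (create (partLabel v) , Realizes-singleton G v∈X X-v=∅)
  ...   | inj₂ (e , r) = inj₂ (addVertex G v∈X (partLabel-suc ∘ X⊆V) hom e r)

  buildable : Buildable G (suc k)
  buildable with build (V G) (⊂-wellFounded (V G)) (λ u∈V → u∈V)
  ... | inj₁ V=∅     = inj₁ V=∅
  ... | inj₂ (e , r) = inj₂ (e , Realizes⇒≅ G r)
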